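{- Let $N\ge 2$ and $m\ge 1$ be integers and let $x^{(r,s)}_k$ ($1\le r,s\le N$, $1\le k\le m$) be elements of a commutative ring; set $x^{(r,s)}_{m+1}=0$ for all $1\le r,s\le N$. Let $E(N,m)$ be the $Nm\times Nm$ matrix which, as an $N\times N$ block matrix with $m\times m$ blocks, has $(r,s)$ block $C_m(x^{(r,s)}_1,\dots,x^{(r,s)}_m)$ if $r$ is even and $A_m(x^{(r,s)}_1,\dots,x^{(r,s)}_m)$ if $r$ is odd. Then $$\det(E(N,m))=\begin{cases}(-1)^{\frac{Nm}{4}}\prod_{i=1}^{m}\det(X_{(i,i+1)}), & N \text{ even},\ m \text{ even},\\[2pt] (-1)^{\frac{N(m-1)}{4}}\prod_{i=1}^{m}\det(X_{(i,i+1)}), & N \text{ even},\ m \text{ odd},\\[2pt] (-1)^{\frac{(N-1)m}{4}}\prod_{i=1}^{m}\det(X_{(i,i+1)}), & N \text{ odd},\ m \text{ even},\\[2pt] (-1)^{\frac{(N-1)(m-1)}{4}}\prod_{i=1}^{m}\det(X_{(i,i+1)}), & N \text{ odd},\ m \text{ odd}.\end{cases}$$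
   Context: For elements $x_1,\dots,x_m$: $A_m(x_1,\dots,x_m)$ is the $m\times m$ matrix with $(p,q)$ entry $x_{m+1-\min(p,q)}$, and $C_m(x_1,\dots,x_m)$ is the $m\times m$ matrix with $(p,q)$ entry $x_{\max(p,\,m+1-q)}$. For $1\le i\le m$, $X_{(i,i+1)}$ is the $N\times N$ matrix whose $(r,s)$ entry is $x^{(r,s)}_i-x^{(r,s)}_{i+1}$. -}

module Defs where

open import Algebra.Bundles using (CommutativeRing; Semiring)
open import Data.Bool.Base using (if_then_else_)
open import Data.Fin.Base using (Fin; zero; suc; toℕ; fromℕ; inject₁; opposite; quotient; remainder)
open import Data.Fin.Properties using (≤-totalOrder)
open import Data.Nat.Base as ℕ using (ℕ; zero; suc)
open import Data.Nat.Divisibility using (_∣?_)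
open import Data.Vec.Functional using (Vector; insertAt; removeAt)
open import Relation.Nullary.Decidable.Core using (does)
import Algebra.Construct.NaturalChoice.Max as Max
import Algebra.Construct.NaturalChoice.Min as Min
import Algebra.Definitions.RawSemiring as RawSemiringDefinitions

-- Throughout, an index running over 1, …, n is represented 0-based: the
-- element i of Fin n stands for toℕ i + 1.

module OverRing {c ℓ} (R : CommutativeRing c ℓ) where

  open CommutativeRing R hiding (zero)
  open RawSemiringDefinitions (Semiring.rawSemiring semiring) public
    using (sum; product; _^_)

  Matrix : ℕ → Set c
  Matrix n = Fin n → Fin n → Carrier

  -- Cofactor expansion along the first row.
  det : ∀ {n} → Matrix n → Carrier
  det {zero}  M = 1#
  det {suc n} M = sum λ j →
    (- 1#) ^ toℕ j * (M zero j * det λ p → removeAt (M (suc p)) j)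

  -- 0-based, the index m+1−k becomes opposite k.
  A : ∀ {m} → Vector Carrier m → Matrix m
  A {m} x p q = x (opposite (p ⊓ q))
    where open Min (≤-totalOrder m) using (_⊓_)

  C : ∀ {m} → Vector Carrier m → Matrix m
  C {m} x p q = x (p ⊔ opposite q)
    where open Max (≤-totalOrder m) using (_⊔_)

  module _ {N m : ℕ} (x : Fin N → Fin N → Vector Carrier m) where

    -- The N × N array of m × m blocks.  The parity test is on the 1-based
    -- row number.
    block : Fin N → Fin N → Matrix m
    block r s = if does (2 ∣? suc (toℕ r)) then C (x r s) else A (x r s)

    -- Row (or column) i of E is row `remainder m i` inside block row
    -- `quotient m i`.
    E : Matrix (N ℕ.* m)
    E i j = block (quotient m i) (quotient m j) (remainder {N} m i) (remainder {N} m j)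

    -- The family x_1, …, x_m extended by x_{m+1} = 0.
    extended : Fin N → Fin N → Vector Carrier (suc m)
    extended r s = insertAt (x r s) (fromℕ m) 0#

    X : Fin m → Matrix N
    X i r s = extended r s (inject₁ i) - extended r s (suc i)

{-# OPTIONS --safe #-}
module Submission where

-- Since x_t = Σ_{i ≥ t} (x_i − x_{i+1}), the array x_{max(t,u)} equals
-- Σ_i [t ≤ i] (x_i − x_{i+1}) [u ≤ i].  Applied to every block this factors E
-- as W D U, where W and U are block diagonal with blocks [t ≤ i], up to
-- reversing the rows or columns, and D, regrouped by i, is block diagonal with
-- blocks X_(i,i+1).  The reversals contribute (−1)^⌊m/2⌋ for each even block row
-- and a square for each odd one.
--
-- Multiplicativity of det and the block diagonal formula both come from the
-- fact that det is, up to a factor, the only alternating multilinear form in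
-- the rows of a square matrix; this needs no permutations.

open import Defs
open import Algebra.Bundles using (CommutativeRing)
open import Data.Bool.Base using (Bool; true; false; if_then_else_)
open import Data.Fin.Base as Fin using (Fin; zero; suc; toℕ; fromℕ; inject₁; opposite; punchIn; combine; remQuot; _↑ˡ_; _↑ʳ_)
open import Data.Nat as ℕ using (ℕ; zero; suc; _≤_; _∸_; _/_)
open import Data.Nat.DivMod using (m*n/n≡m)
open import Data.Nat.Divisibility using (_∣_; _∤_; _∣?_; divides; ∣m+n∣m⇒∣n; ∣m∣n⇒∣m+n; ∣-refl; ∣1⇒≡1)
open import Data.Product.Algebra using (×-comm)
open import Data.Product.Base using (_×_; _,_; proj₁; proj₂; ∃)
open import Data.Sum.Base as Sum using (_⊎_; inj₁; inj₂)
open import Data.Unit.Base using (⊤; tt)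
open import Data.Vec.Functional using (Vector; _∷_; tail; updateAt; insertAt)
open import Data.Vec.Functional.Properties using (updateAt-updates; updateAt-minimal)
open import Function.Base using (_∘_; const)
open import Function.Bundles using (_↔_; Inverse; mk⇔)
open import Function.Construct.Composition using (_↔-∘_)
open import Level using (0ℓ; _⊔_)
open import Relation.Binary.Core using (Rel)
open import Relation.Binary.PropositionalEquality.Core as ≡ using (_≡_; _≢_)
open import Relation.Nullary.Decidable using (does-⇔)
open import Relation.Nullary.Decidable.Core using (yes; no; does)
open import Relation.Nullary.Negation using (contradiction)
import Algebra.Properties.CommutativeMonoid.Sum as MonoidSum
import Algebra.Properties.Ring as RingProperties
import Algebra.Properties.Semiring.Exp as Exp
import Algebra.Properties.Semiring.Sum as SemiringSum
import Algebra.Solver.Ring.NaturalCoefficients.Default as Solver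
import Data.Fin.Properties as Fin
import Data.Nat.Properties as ℕ
import Data.Nat.Solver as ℕ-Solver
import Relation.Binary.Reasoning.Setoid as SetoidReasoning

module Determinants {c ℓ} (R : CommutativeRing c ℓ) where

  open CommutativeRing R hiding (zero)
  open OverRing R
  open SemiringSum semiring
    using (sum-cong-≋; sum-replicate-zero; ∑-distrib-+; sum-remove; sum-init-last; *-distribˡ-sum; *-distribʳ-sum)
  open MonoidSum *-commutativeMonoid using ()
    renaming (sum-cong-≋ to product-cong-≋; ∑-distrib-+ to ∏-distrib-*)
  open Exp semiring using (^-assocʳ)
  open RingProperties ring using (-1*x≈-x; -‿involutive; +-inverseˡ-unique)
  open Solver commutativeSemiring using (solve; _:+_; _:*_; _:=_; con)
  open SetoidReasoning setoid

  -- Signs, finite sums and the identity matrix.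

  s : Carrier
  s = - 1#

  s*s≈1 : s * s ≈ 1#
  s*s≈1 = trans (-1*x≈-x s) (-‿involutive 1#)

  x+sx≈0 : ∀ x → x + s * x ≈ 0#
  x+sx≈0 x = trans (+-congˡ (-1*x≈-x x)) (-‿inverseʳ x)

  x+y≈0⇒x≈sy : ∀ {x y} → x + y ≈ 0# → x ≈ s * y
  x+y≈0⇒x≈sy eq = trans (+-inverseˡ-unique _ _ eq) (sym (-1*x≈-x _))

  sⁿ*sⁿ≈1 : ∀ n → s ^ n * s ^ n ≈ 1#
  sⁿ*sⁿ≈1 zero = *-identityˡ 1#
  sⁿ*sⁿ≈1 (suc n) = begin
    (s * s ^ n) * (s * s ^ n)  ≈⟨ solve 2 (λ a b → (a :* b) :* (a :* b) := (a :* a) :* (b :* b)) refl s (s ^ n) ⟩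
    (s * s) * (s ^ n * s ^ n)  ≈⟨ *-cong s*s≈1 (sⁿ*sⁿ≈1 n) ⟩
    1# * 1#                    ≈⟨ *-identityˡ 1# ⟩
    1#                         ∎

  sⁿx≈0⇒x≈0 : ∀ n {x} → s ^ n * x ≈ 0# → x ≈ 0#
  sⁿx≈0⇒x≈0 n {x} eq = begin
    x                    ≈⟨ *-identityˡ x ⟨
    1# * x               ≈⟨ *-congʳ (sⁿ*sⁿ≈1 n) ⟨
    s ^ n * s ^ n * x    ≈⟨ *-assoc _ _ _ ⟩
    s ^ n * (s ^ n * x)  ≈⟨ *-congˡ eq ⟩
    s ^ n * 0#           ≈⟨ zeroʳ _ ⟩
    0#                   ∎

  sum≈0 : ∀ {n} {f : Vector Carrier n} → (∀ i → f i ≈ 0#) → sum f ≈ 0#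
  sum≈0 {n} f≈0 = trans (sum-cong-≋ f≈0) (sum-replicate-zero n)

  sum-linear : ∀ {n} a (f g : Vector Carrier n) → sum (λ i → a * f i + g i) ≈ a * sum f + sum g
  sum-linear a f g = trans (∑-distrib-+ (λ i → a * f i) g) (+-congʳ (sym (*-distribˡ-sum a f)))

  infix 4 _≋_
  _≋_ : ∀ {n} → Rel (Vector Carrier n) ℓ
  u ≋ v = ∀ j → u j ≈ v j

  -- The identity matrix, defined by recursion so that its rows and its first minor reduce by
  -- computation.
  δ : ∀ {n} → Matrix n
  δ zero    zero    = 1#
  δ zero    (suc j) = 0#
  δ (suc i) zero    = 0#
  δ (suc i) (suc j) = δ i j

  δ-refl : ∀ {n} (i : Fin n) → δ i i ≈ 1#
  δ-refl zero    = refl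
  δ-refl (suc i) = δ-refl i

  δ-≢ : ∀ {n} {i j : Fin n} → i ≢ j → δ i j ≈ 0#
  δ-≢ {i = zero}  {zero}  i≢j = contradiction ≡.refl i≢j
  δ-≢ {i = zero}  {suc j} _   = refl
  δ-≢ {i = suc i} {zero}  _   = refl
  δ-≢ {i = suc i} {suc j} i≢j = δ-≢ (i≢j ∘ ≡.cong suc)

  δ-comm : ∀ {n} (i j : Fin n) → δ i j ≈ δ j i
  δ-comm zero    zero    = refl
  δ-comm zero    (suc j) = refl
  δ-comm (suc i) zero    = refl
  δ-comm (suc i) (suc j) = δ-comm i j

  sum-δˡ : ∀ {n} i (f : Vector Carrier n) → sum (λ k → δ i k * f k) ≈ f i
  sum-δˡ zero f = begin
    1# * f zero + sum (λ k → 0# * f (suc k))  ≈⟨ +-cong (*-identityˡ _) (sum≈0 (λ k → zeroˡ (f (suc k)))) ⟩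
    f zero + 0#                               ≈⟨ +-identityʳ _ ⟩
    f zero                                    ∎
  sum-δˡ (suc i) f = begin
    0# * f zero + sum (λ k → δ i k * f (suc k))  ≈⟨ +-cong (zeroˡ _) (sum-δˡ i (f ∘ suc)) ⟩
    0# + f (suc i)                               ≈⟨ +-identityˡ _ ⟩
    f (suc i)                                    ∎

  sum-δʳ : ∀ {n} i (f : Vector Carrier n) → sum (λ k → f k * δ k i) ≈ f i
  sum-δʳ i f = trans (sum-cong-≋ (λ k → trans (*-comm _ _) (*-congʳ (δ-comm k i)))) (sum-δˡ i f)

  -- Alternating multilinear forms.

  -- Rows are indexed by an arbitrary type, and only rows related by _~_ are
  -- required to alternate: this covers forms in the rows of one matrix as well
  -- as forms in a family of matrices that are alternating in each of them.
  record IsAlternating {I : Set} (_~_ : Rel I 0ℓ) {n} (F : (I → Vector Carrier n) → Carrier) : Set (c ⊔ ℓ) where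
    field
      cong      : ∀ {M M′} → (∀ i → M i ≋ M′ i) → F M ≈ F M′
      linear    : ∀ i a {M U V} → (∀ j → M i j ≈ a * U i j + V i j) →
                  (∀ k → k ≢ i → M k ≋ U k) → (∀ k → k ≢ i → M k ≋ V k) →
                  F M ≈ a * F U + F V
      alternate : ∀ {i k M} → i ≢ k → i ~ k → M i ≋ M k → F M ≈ 0#

  open IsAlternating

  Form : ∀ {m n} → ((Fin m → Vector Carrier n) → Carrier) → Set (c ⊔ ℓ)
  Form = IsAlternating (λ _ _ → ⊤)

  infixl 7 _·_
  _·_ : ∀ {I : Set} {n p} → (I → Vector Carrier n) → (Fin n → Vector Carrier p) → I → Vector Carrier p
  (M · B) i q = sum λ k → M i k * B k q

  -- Row `i` of `M · B` is a linear image of row `i` of `M` alone, so the laws pull back along right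
  -- multiplication. With `F = det` this leads to the product formula.
  ·-form : ∀ {I : Set} {_~_ : Rel I 0ℓ} {n p} {F : (I → Vector Carrier p) → Carrier} →
           IsAlternating _~_ F → (B : Fin n → Vector Carrier p) → IsAlternating _~_ (λ M → F (M · B))
  ·-form {F = F} form B = record
    { cong = λ M≋M′ → cong form λ i → same (M≋M′ i)
    ; linear = λ i a {M} {U} {V} eq eqU eqV → linear form i a
        (λ q → begin
          sum (λ k → M i k * B k q)
            ≈⟨ sum-cong-≋ (λ k → trans (*-congʳ (eq k))
                 (solve 4 (λ a u v b → (a :* u :+ v) :* b := a :* (u :* b) :+ v :* b) refl a (U i k) (V i k) (B k q))) ⟩
          sum (λ k → a * (U i k * B k q) + V i k * B k q)
            ≈⟨ sum-linear a (λ k → U i k * B k q) (λ k → V i k * B k q) ⟩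
          a * sum (λ k → U i k * B k q) + sum (λ k → V i k * B k q) ∎)
        (λ k k≢i → same (eqU k k≢i)) (λ k k≢i → same (eqV k k≢i))
    ; alternate = λ i≢k i~k eq → alternate form i≢k i~k (same eq)
    }
    where
    same : ∀ {u v} → u ≋ v → ∀ q → sum (λ k → u k * B k q) ≈ sum (λ k → v k * B k q)
    same u≋v q = sum-cong-≋ λ k → *-congʳ (u≋v k)

  -- With `φ = punchIn j` this deletes column `j`, which makes the minors of the cofactor expansion
  -- forms in the remaining rows.
  select-form : ∀ {I : Set} {_~_ : Rel I 0ℓ} {n p} {F : (I → Vector Carrier p) → Carrier} →
                IsAlternating _~_ F → (φ : Fin p → Fin n) → IsAlternating _~_ (λ M → F (λ i → M i ∘ φ))
  select-form form φ = record
    { cong = λ eq → cong form λ i → eq i ∘ φ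
    ; linear = λ i a eq eqU eqV → linear form i a (eq ∘ φ) (λ k k≢i → eqU k k≢i ∘ φ) (λ k k≢i → eqV k k≢i ∘ φ)
    ; alternate = λ i≢k i~k eq → alternate form i≢k i~k (eq ∘ φ)
    }

  scale-form : ∀ {I : Set} {_~_ : Rel I 0ℓ} {n} {F : (I → Vector Carrier n) → Carrier} →
               ∀ b → IsAlternating _~_ F → IsAlternating _~_ (λ M → b * F M)
  scale-form b form = record
    { cong = λ eq → *-congˡ (cong form eq)
    ; linear = λ i a eq eqU eqV → trans (*-congˡ (linear form i a eq eqU eqV))
        (solve 4 (λ b a u v → b :* (a :* u :+ v) := a :* (b :* u) :+ b :* v) refl b a _ _)
    ; alternate = λ i≢k i~k eq → trans (*-congˡ (alternate form i≢k i~k eq)) (zeroʳ b)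
    }

  sum-form : ∀ {I : Set} {_~_ : Rel I 0ℓ} {n p} {F : Fin p → (I → Vector Carrier n) → Carrier} →
             (∀ j → IsAlternating _~_ (F j)) → IsAlternating _~_ (λ M → sum (λ j → F j M))
  sum-form {F = F} forms = record
    { cong = λ eq → sum-cong-≋ λ j → cong (forms j) eq
    ; linear = λ i a {M} {U} {V} eq eqU eqV →
        trans (sum-cong-≋ λ j → linear (forms j) i a eq eqU eqV) (sum-linear a (λ j → F j U) (λ j → F j V))
    ; alternate = λ i≢k i~k eq → sum≈0 λ j → alternate (forms j) i≢k i~k eq
    }

  ∷-form : ∀ {m n} {F : (Fin (suc m) → Vector Carrier n) → Carrier} →
           Form F → ∀ u → Form (λ M → F (u ∷ M))
  ∷-form form u = record
    { cong = λ eq → cong form λ { zero j → refl ; (suc i) → eq i }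
    ; linear = λ i a eq eqU eqV → linear form (suc i) a eq
        (λ { zero _ j → refl ; (suc k) k≢i → eqU k (k≢i ∘ ≡.cong suc) })
        (λ { zero _ j → refl ; (suc k) k≢i → eqV k (k≢i ∘ ≡.cong suc) })
    ; alternate = λ i≢k i~k eq → alternate form (i≢k ∘ Fin.suc-injective) i~k eq
    }

  linear-head : ∀ {m n} {F : (Fin (suc m) → Vector Carrier n) → Carrier} → Form F →
                ∀ a {w u v M} → (∀ j → w j ≈ a * u j + v j) → F (w ∷ M) ≈ a * F (u ∷ M) + F (v ∷ M)
  linear-head form a eq = linear form zero a eq
    (λ { zero 0≢0 → contradiction ≡.refl 0≢0 ; (suc k) _ j → refl })
    (λ { zero 0≢0 → contradiction ≡.refl 0≢0 ; (suc k) _ j → refl })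

  -- Polarisation: the form vanishes when both leading rows are `u + v`, and two of the four terms
  -- of its expansion vanish as well.
  swap : ∀ {m n} {F : (Fin (suc (suc m)) → Vector Carrier n) → Carrier} → Form F →
         ∀ u v M → F (u ∷ (v ∷ M)) ≈ s * F (v ∷ (u ∷ M))
  swap {F = F} form u v M = x+y≈0⇒x≈sy (sym (begin
    0#                           ≈⟨ alternate form {zero} {suc zero} (λ ()) tt (λ j → refl) ⟨
    F (w ∷ (w ∷ M))              ≈⟨ linear-head form 1# (λ j → sum≈ (u j) (v j)) ⟩
    1# * F (u ∷ (w ∷ M)) + F (v ∷ (w ∷ M))
      ≈⟨ +-cong (*-congˡ (linear-head (∷-form form u) 1# (λ j → sum≈ (u j) (v j))))
                (linear-head (∷-form form v) 1# (λ j → sum≈ (u j) (v j))) ⟩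
    1# * (1# * F (u ∷ (u ∷ M)) + F (u ∷ (v ∷ M))) + (1# * F (v ∷ (u ∷ M)) + F (v ∷ (v ∷ M)))
      ≈⟨ +-cong (*-congˡ (+-congʳ (*-congˡ (repeated u)))) (+-congˡ (repeated v)) ⟩
    1# * (1# * 0# + F (u ∷ (v ∷ M))) + (1# * F (v ∷ (u ∷ M)) + 0#)
      ≈⟨ solve 2 (λ x y → con 1 :* (con 1 :* con 0 :+ x) :+ (con 1 :* y :+ con 0) := x :+ y) refl _ _ ⟩
    F (u ∷ (v ∷ M)) + F (v ∷ (u ∷ M)) ∎))
    where
    w = λ j → u j + v j
    sum≈ : ∀ x y → x + y ≈ 1# * x + y
    sum≈ x y = +-congʳ (sym (*-identityˡ x))
    repeated : ∀ t → F (t ∷ (t ∷ M)) ≈ 0#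
    repeated t = alternate form {zero} {suc zero} (λ ()) tt (λ j → refl)

  -- Row `j` passes the `j` rows above it by adjacent swaps, each costing a factor `s`. After the
  -- first swap `M zero` is back in place and is frozen by `∷-form`.
  row-to-front : ∀ {m n} {F : (Fin (suc m) → Vector Carrier n) → Carrier} → Form F →
                 ∀ j M → F (M j ∷ (M ∘ punchIn j)) ≈ s ^ toℕ j * F M
  row-to-front form zero M =
    trans (cong form λ { zero j → refl ; (suc i) j → refl }) (sym (*-identityˡ _))
  row-to-front {suc m} {F = F} form (suc j) M = begin
    F (M (suc j) ∷ (M ∘ punchIn (suc j)))
      ≈⟨ cong form (λ { zero _ → refl ; (suc zero) _ → refl ; (suc (suc i)) _ → refl }) ⟩
    F (M (suc j) ∷ (M zero ∷ (tail M ∘ punchIn j)))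
      ≈⟨ swap form _ _ _ ⟩
    s * F (M zero ∷ (M (suc j) ∷ (tail M ∘ punchIn j)))
      ≈⟨ *-congˡ (row-to-front (∷-form form (M zero)) j (tail M)) ⟩
    s * (s ^ toℕ j * F (M zero ∷ tail M))
      ≈⟨ *-assoc _ _ _ ⟨
    s ^ toℕ (suc j) * F (M zero ∷ tail M)
      ≈⟨ *-congˡ (cong form λ { zero _ → refl ; (suc i) _ → refl }) ⟩
    s ^ toℕ (suc j) * F M ∎

  -- Cancellation in the expansion along two rows.

  -- Two nested removals of columns, j then k and j′ then k′, that remove the
  -- same two columns in opposite orders.
  data Opposed : ∀ {n} → Fin (suc n) → Fin n → Fin (suc n) → Fin n → Set where
    base : ∀ {n} {k : Fin (suc n)} → Opposed zero k (suc k) zero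
    step : ∀ {n} {j j′ : Fin (suc n)} {k k′ : Fin n} → Opposed j k j′ k′ → Opposed (suc j) (suc k) (suc j′) (suc k′)

  -- Opposed pairs partition the index set: `(zero , k)` is matched with `(suc k , zero)`, and the
  -- pairs with both entries nonzero are matched by recursion.
  sum-opposed : ∀ {n} (T : Fin (suc n) → Fin n → Carrier) →
                (∀ {j k j′ k′} → Opposed j k j′ k′ → T j k + T j′ k′ ≈ 0#) →
                sum (λ j → sum (T j)) ≈ 0#
  sum-opposed {zero} T _ = +-identityˡ 0#
  sum-opposed {suc n} T cancel = begin
    sum (T zero) + sum (λ j → T (suc j) zero + sum (λ k → T (suc j) (suc k)))
      ≈⟨ +-congˡ (∑-distrib-+ (λ j → T (suc j) zero) (λ j → sum (λ k → T (suc j) (suc k)))) ⟩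
    sum (T zero) + (sum (λ j → T (suc j) zero) + sum (λ j → sum (λ k → T (suc j) (suc k))))
      ≈⟨ +-assoc _ _ _ ⟨
    sum (T zero) + sum (λ j → T (suc j) zero) + sum (λ j → sum (λ k → T (suc j) (suc k)))
      ≈⟨ +-cong (sym (∑-distrib-+ (T zero) (λ j → T (suc j) zero))) (sum-opposed (λ j k → T (suc j) (suc k)) (cancel ∘ step)) ⟩
    sum (λ k → T zero k + T (suc k) zero) + 0#
      ≈⟨ +-identityʳ _ ⟩
    sum (λ k → T zero k + T (suc k) zero)
      ≈⟨ sum≈0 {f = λ k → T zero k + T (suc k) zero} (λ k → cancel base) ⟩
    0# ∎

  opposed-punchIn : ∀ {n} {j j′ : Fin (suc (suc n))} {k k′} → Opposed j k j′ k′ →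
                    ∀ q → punchIn j (punchIn k q) ≡ punchIn j′ (punchIn k′ q)
  opposed-punchIn base     q       = ≡.refl
  opposed-punchIn (step o) zero    = ≡.refl
  opposed-punchIn (step o) (suc q) = ≡.cong suc (opposed-punchIn o q)

  -- `k` counts columns after `j` is gone. In the original numbering it names the column that the
  -- opposite order removes first.
  opposed-first : ∀ {n} {j j′ : Fin (suc n)} {k k′} → Opposed j k j′ k′ → j′ ≡ punchIn j k × j ≡ punchIn j′ k′
  opposed-first base     = ≡.refl , ≡.refl
  opposed-first (step o) with opposed-first o
  ... | p , q = ≡.cong suc p , ≡.cong suc q

  -- In the base case the exponents sum to `k` on one side and `k + 1` on the other. Each step
  -- raises both sums by two and so keeps them one apart in parity.
  opposed-sign : ∀ {n} {j j′ : Fin (suc n)} {k k′} → Opposed j k j′ k′ →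
                 s ^ toℕ j′ * s ^ toℕ k′ ≈ s * (s ^ toℕ j * s ^ toℕ k)
  opposed-sign {k = k} base = solve 2 (λ s t → (s :* t) :* con 1 := s :* (con 1 :* t)) refl s (s ^ toℕ k)
  opposed-sign {j = suc j} {suc j′} {suc k} {suc k′} (step o) = begin
    (s * s ^ toℕ j′) * (s * s ^ toℕ k′)     ≈⟨ shuffle s _ _ ⟩
    (s * s) * (s ^ toℕ j′ * s ^ toℕ k′)     ≈⟨ *-congˡ (opposed-sign o) ⟩
    (s * s) * (s * (s ^ toℕ j * s ^ toℕ k)) ≈⟨ solve 3 (λ s a b → (s :* s) :* (s :* (a :* b)) := s :* ((s :* a) :* (s :* b))) refl s _ _ ⟩
    s * ((s * s ^ toℕ j) * (s * s ^ toℕ k)) ∎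
    where
    shuffle : ∀ s a b → (s * a) * (s * b) ≈ (s * s) * (a * b)
    shuffle = solve 3 (λ s a b → (s :* a) :* (s :* b) := (s :* s) :* (a :* b)) refl

  det-cong : ∀ {n} {M M′ : Matrix n} → (∀ i → M i ≋ M′ i) → det M ≈ det M′
  det-cong {zero}  eq = refl
  det-cong {suc n} eq = sum-cong-≋ λ j →
    *-congˡ {s ^ toℕ j} (*-cong (eq zero j) (det-cong λ p → eq (suc p) ∘ punchIn j))

  -- Expanding along both rows gives a sum over ordered pairs of removed columns. Opposed pairs
  -- leave the same minor and, since the rows agree, the same product of entries, but have opposite
  -- signs.
  det-equal-first : ∀ {n} {u v : Vector Carrier (suc (suc n))} M → u ≋ v → det (u ∷ (v ∷ M)) ≈ 0#
  det-equal-first {n} {u} {v} M u≋v = begin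
    sum (λ j → s ^ toℕ j * (u j * sum (λ k → s ^ toℕ k * (v (punchIn j k) * D j k))))
      ≈⟨ sum-cong-≋ (λ j → trans (sym (*-assoc _ _ _)) (*-distribˡ-sum (s ^ toℕ j * u j) (λ k → s ^ toℕ k * (v (punchIn j k) * D j k)))) ⟩
    sum (λ j → sum (T j))
      ≈⟨ sum-opposed T cancel ⟩
    0# ∎
    where
    D : Fin (suc (suc n)) → Fin (suc n) → Carrier
    D j k = det λ p q → M p (punchIn j (punchIn k q))
    T : Fin (suc (suc n)) → Fin (suc n) → Carrier
    T j k = s ^ toℕ j * u j * (s ^ toℕ k * (v (punchIn j k) * D j k))
    cancel : ∀ {j k j′ k′} → Opposed j k j′ k′ → T j k + T j′ k′ ≈ 0#
    cancel {j} {k} {j′} {k′} o = begin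
      T j k + T j′ k′
        ≈⟨ +-cong (rearrange _ _ _ _ _) (rearrange _ _ _ _ _) ⟩
      (s ^ toℕ j * s ^ toℕ k) * (u j * v (punchIn j k) * D j k) +
      (s ^ toℕ j′ * s ^ toℕ k′) * (u j′ * v (punchIn j′ k′) * D j′ k′)
        ≈⟨ +-congˡ (*-cong (opposed-sign o) (*-cong (trans (*-cong u≈v v≈u) (*-comm _ _)) D≈D)) ⟩
      (s ^ toℕ j * s ^ toℕ k) * (u j * v (punchIn j k) * D j k) +
      s * (s ^ toℕ j * s ^ toℕ k) * (u j * v (punchIn j k) * D j k)
        ≈⟨ +-congˡ (*-assoc _ _ _) ⟩
      (s ^ toℕ j * s ^ toℕ k) * (u j * v (punchIn j k) * D j k) +
      s * ((s ^ toℕ j * s ^ toℕ k) * (u j * v (punchIn j k) * D j k))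
        ≈⟨ x+sx≈0 _ ⟩
      0# ∎
      where
      rearrange : ∀ a x b y d → a * x * (b * (y * d)) ≈ (a * b) * (x * y * d)
      rearrange = solve 5 (λ a x b y d → a :* x :* (b :* (y :* d)) := (a :* b) :* (x :* y :* d)) refl
      u≈v : u j′ ≈ v (punchIn j k)
      u≈v = trans (u≋v j′) (reflexive (≡.cong v (proj₁ (opposed-first o))))
      v≈u : v (punchIn j′ k′) ≈ u j
      v≈u = trans (reflexive (≡.cong v (≡.sym (proj₂ (opposed-first o))))) (sym (u≋v j))
      D≈D : D j′ k′ ≈ D j k
      D≈D = det-cong λ p q → reflexive (≡.cong (M p) (≡.sym (opposed-punchIn o q)))

  -- The determinant is an alternating form.

  mutual
    -- The recursion is on the size: with its first row fixed, a determinant is a combination of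
    -- smaller ones, which are forms by induction. Only laws that involve the first row need a
    -- separate argument.
    det-form : ∀ {n} → Form (det {n})
    det-form {n} = record { cong = det-cong ; linear = det-linear ; alternate = λ i≢k _ → det-alternate i≢k }

    det-tail-form : ∀ {n} (u : Vector Carrier (suc n)) → Form (λ M → det (u ∷ M))
    det-tail-form u = sum-form λ j → scale-form (s ^ toℕ j) (scale-form (u j) (select-form det-form (punchIn j)))

    det-linear : ∀ {n} i a {M U V : Matrix n} → (∀ j → M i j ≈ a * U i j + V i j) →
                 (∀ k → k ≢ i → M k ≋ U k) → (∀ k → k ≢ i → M k ≋ V k) → det M ≈ a * det U + det V
    det-linear {suc n} zero a {M} {U} {V} eq eqU eqV = begin
      det M
        ≈⟨ sum-cong-≋ (λ j → trans (*-congˡ (trans (*-congʳ (eq j)) (trans (distribʳ _ _ _)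
             (+-cong (*-congˡ (minor j eqU)) (*-congˡ (minor j eqV))))))
             (solve 6 (λ t a u v d e → t :* (a :* u :* d :+ v :* e) := a :* (t :* (u :* d)) :+ t :* (v :* e)) refl
               (s ^ toℕ j) a (U zero j) (V zero j) _ _)) ⟩
      sum (λ j → a * (s ^ toℕ j * (U zero j * det λ p → U (suc p) ∘ punchIn j)) +
                 s ^ toℕ j * (V zero j * det λ p → V (suc p) ∘ punchIn j))
        ≈⟨ sum-linear a (λ j → s ^ toℕ j * (U zero j * det λ p → U (suc p) ∘ punchIn j))
                        (λ j → s ^ toℕ j * (V zero j * det λ p → V (suc p) ∘ punchIn j)) ⟩
      a * det U + det V ∎
      where
      minor : ∀ j {W : Matrix (suc n)} → (∀ k → k ≢ zero → M k ≋ W k) →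
              det (λ p → M (suc p) ∘ punchIn j) ≈ det (λ p → W (suc p) ∘ punchIn j)
      minor j eqW = det-cong λ p → eqW (suc p) (λ ()) ∘ punchIn j
    det-linear {suc n} (suc i) a {M} {U} {V} eq eqU eqV = begin
      det (M zero ∷ tail M)
        ≈⟨ linear (det-tail-form (M zero)) i a eq
             (λ k k≢i → eqU (suc k) (k≢i ∘ Fin.suc-injective)) (λ k k≢i → eqV (suc k) (k≢i ∘ Fin.suc-injective)) ⟩
      a * det (M zero ∷ tail U) + det (M zero ∷ tail V)
        ≈⟨ +-cong (*-congˡ (det-cong {M = M zero ∷ tail U} {U} λ { zero → eqU zero (λ ()) ; (suc k) j → refl }))
                  (det-cong {M = M zero ∷ tail V} {V} λ { zero → eqV zero (λ ()) ; (suc k) j → refl }) ⟩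
      a * det U + det V ∎

    det-alternate : ∀ {n} {i k} {M : Matrix n} → i ≢ k → M i ≋ M k → det M ≈ 0#
    det-alternate {suc n} {zero}  {zero}  0≢0 _ = contradiction ≡.refl 0≢0
    det-alternate {suc n} {zero}  {suc k} {M} _ eq = det-alternate-head k {M} eq
    det-alternate {suc n} {suc i} {zero}  {M} _ eq = det-alternate-head i {M} (λ j → sym (eq j))
    det-alternate {suc n} {suc i} {suc k} {M} i≢k eq =
      alternate (det-tail-form (M zero)) (i≢k ∘ ≡.cong suc) tt eq

    -- The row equal to the first is moved up next to it, where `det-equal-first` applies. The sign
    -- this costs is its own inverse and can be cancelled.
    det-alternate-head : ∀ {n} k {M : Matrix (suc n)} → M zero ≋ M (suc k) → det M ≈ 0#
    det-alternate-head {suc n} k {M} eq = sⁿx≈0⇒x≈0 (toℕ k) (begin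
      s ^ toℕ k * det (M zero ∷ tail M)
        ≈⟨ row-to-front (det-tail-form (M zero)) k (tail M) ⟨
      det (M zero ∷ (M (suc k) ∷ (tail M ∘ punchIn k)))
        ≈⟨ det-equal-first (tail M ∘ punchIn k) eq ⟩
      0# ∎)

  -- Uniqueness of alternating forms and multiplicativity.

  -- The first coordinate is split off through `u = u zero δ zero + (0# ∷ tail u)`, and `f` is again
  -- linear on vectors that start with `0#`.
  linear-≈-sum : ∀ {n} {f : Vector Carrier n → Carrier} →
                 (∀ {u v} → u ≋ v → f u ≈ f v) →
                 (∀ a {w u v} → (∀ j → w j ≈ a * u j + v j) → f w ≈ a * f u + f v) →
                 ∀ u → f u ≈ sum (λ j → u j * f (δ j))
  linear-≈-sum {zero} {f} f-cong f-linear u = begin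
    -- All vectors of length zero agree, so linearity holds with any coefficient; `s` is chosen to
    -- make the two terms cancel.
    f u              ≈⟨ f-linear s {u} {u} {u} (λ ()) ⟩
    s * f u + f u    ≈⟨ +-comm _ _ ⟩
    f u + s * f u    ≈⟨ x+sx≈0 (f u) ⟩
    0#               ∎
  linear-≈-sum {suc n} {f} f-cong f-linear u = begin
    f u
      ≈⟨ f-linear (u zero) (λ { zero → sym (trans (+-identityʳ _) (*-identityʳ _))
                              ; (suc j) → sym (trans (+-congʳ (zeroʳ _)) (+-identityˡ _)) }) ⟩
    u zero * f (δ zero) + f (0# ∷ tail u)
      ≈⟨ +-congˡ (linear-≈-sum {f = λ v → f (0# ∷ v)}
           (λ u≋v → f-cong λ { zero → refl ; (suc j) → u≋v j })
           (λ a eq → f-linear a λ { zero → sym (trans (+-identityʳ _) (zeroʳ a)) ; (suc j) → eq j })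
           (tail u)) ⟩
    u zero * f (δ zero) + sum (λ j → u (suc j) * f (0# ∷ δ j))
      ≈⟨ +-congˡ (sum-cong-≋ λ j → *-congˡ {u (suc j)} (f-cong λ { zero → refl ; (suc k) → refl })) ⟩
    u zero * f (δ zero) + sum (λ j → u (suc j) * f (δ (suc j))) ∎

  -- Rows are exchanged one at a time, those already exchanged being absorbed into `F`. This reduces
  -- a change of all rows to a change of one.
  replace-rows : ∀ {m n} (_~_ : Rel (Vector Carrier n) (c ⊔ ℓ)) {F : (Fin m → Vector Carrier n) → Carrier} →
                 (∀ {M M′} → (∀ i → M i ≋ M′ i) → F M ≈ F M′) →
                 (∀ i {M M′} → M i ~ M′ i → (∀ k → k ≢ i → M k ≋ M′ k) → F M ≈ F M′) →
                 ∀ {M M′} → (∀ i → M i ~ M′ i) → F M ≈ F M′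
  replace-rows {zero}  _~_     F-cong F-step M~M′ = F-cong λ ()
  replace-rows {suc m} _~_ {F} F-cong F-step {M} {M′} M~M′ = begin
    F M
      ≈⟨ F-step zero (M~M′ zero) (λ { zero 0≢0 → contradiction ≡.refl 0≢0 ; (suc k) _ j → refl }) ⟩
    F (M′ zero ∷ tail M)
      ≈⟨ replace-rows _~_ {λ N → F (M′ zero ∷ N)}
           (λ eq → F-cong λ { zero j → refl ; (suc i) → eq i })
           (λ i rel eq → F-step (suc i) rel λ { zero _ j → refl ; (suc k) k≢i → eq k (k≢i ∘ ≡.cong suc) })
           {tail M} {tail M′} (M~M′ ∘ suc) ⟩
    F (M′ zero ∷ tail M′)
      ≈⟨ F-cong (λ { zero j → refl ; (suc i) j → refl }) ⟩
    F M′ ∎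

  -- By linearity, the multiple of `u` in row `i` contributes a term in which `u` is both the head
  -- and row `i`, and that term vanishes.
  add-multiples-of-head : ∀ {m n} {F : (Fin (suc m) → Vector Carrier n) → Carrier} → Form F → ∀ u {M M′} →
                          (∀ i → ∃ λ a → ∀ q → M i q ≈ a * u q + M′ i q) → F (u ∷ M) ≈ F (u ∷ M′)
  add-multiples-of-head {F = F} form u =
    replace-rows (λ v w → ∃ λ a → ∀ q → v q ≈ a * u q + w q) (cong (∷-form form u)) one-row
    where
    one-row : ∀ i {M M′} → (∃ λ a → ∀ q → M i q ≈ a * u q + M′ i q) → (∀ k → k ≢ i → M k ≋ M′ k) →
              F (u ∷ M) ≈ F (u ∷ M′)
    one-row i {M} {M′} (a , eq) others = begin
      F (u ∷ M)
        ≈⟨ linear (∷-form form u) i a {M} {N} {M′}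
             (λ q → trans (eq q) (+-congʳ (*-congˡ (reflexive (≡.cong (λ v → v q) (≡.sym Nᵢ≡u))))))
             (λ k k≢i q → trans (others k k≢i q)
               (reflexive (≡.cong (λ v → v q) (≡.sym (updateAt-minimal k i M′ k≢i)))))
             others ⟩
      a * F (u ∷ N) + F (u ∷ M′)
        ≈⟨ +-congʳ (*-congˡ (alternate form {zero} {suc i} {u ∷ N} (λ ()) tt
             (λ q → reflexive (≡.cong (λ v → v q) (≡.sym Nᵢ≡u))))) ⟩
      a * 0# + F (u ∷ M′)
        ≈⟨ +-congʳ (zeroʳ a) ⟩
      0# + F (u ∷ M′)
        ≈⟨ +-identityˡ _ ⟩
      F (u ∷ M′) ∎
      where
      N = updateAt M′ i (const u)
      Nᵢ≡u : N i ≡ u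
      Nᵢ≡u = updateAt-updates i M′

  δ· : ∀ {n p} (B : Fin n → Vector Carrier p) → ∀ i → (δ · B) i ≋ B i
  δ· B i q = sum-δˡ i (λ k → B k q)

  -- The first row is expanded in the standard basis. In the term with head `δ j`, row operations
  -- clear column `j` below, which leaves a form in the minor, known by induction. Its value at the
  -- identity is that of `F` at `δ` with row `j` moved to the front, so the terms are those of the
  -- cofactor expansion.
  form-≈-det : ∀ {n} {F : Matrix n → Carrier} → Form F → ∀ M → F M ≈ det M * F δ
  form-≈-det {zero}  {F} form M = trans (cong form λ ()) (sym (*-identityˡ _))
  form-≈-det {suc n} {F} form M = begin
    F M
      ≈⟨ cong form (λ { zero _ → refl ; (suc i) _ → refl }) ⟩
    F (M zero ∷ tail M)
      ≈⟨ linear-≈-sum {f = λ u → F (u ∷ tail M)}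
           (λ u≋v → cong form λ { zero → u≋v ; (suc i) _ → refl })
           (λ a eq → linear-head form a eq) (M zero) ⟩
    sum (λ j → M zero j * F (δ j ∷ tail M))
      ≈⟨ sum-cong-≋ term ⟩
    sum (λ j → s ^ toℕ j * (M zero j * det (minor j)) * F δ)
      ≈⟨ *-distribʳ-sum (F δ) (λ j → s ^ toℕ j * (M zero j * det (minor j))) ⟨
    det M * F δ ∎
    where
    minor : Fin (suc n) → Matrix n
    minor j p = M (suc p) ∘ punchIn j
    split-column : ∀ j (v : Vector Carrier (suc n)) q →
                   v q ≈ v j * δ j q + sum (λ k → v (punchIn j k) * δ (punchIn j k) q)
    split-column j v q = trans (sym (sum-δʳ q v)) (sum-remove {i = j} (λ k → v k * δ k q))
    term : ∀ j → M zero j * F (δ j ∷ tail M) ≈ s ^ toℕ j * (M zero j * det (minor j)) * F δ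
    term j = begin
      M zero j * F (δ j ∷ tail M)
        -- Each lower row loses its `δ j` component; the rest is a row of the minor, embedded by
        -- `δ ∘ punchIn j`.
        ≈⟨ *-congˡ (add-multiples-of-head form (δ j) (λ p → M (suc p) j , split-column j (M (suc p)))) ⟩
      M zero j * F (δ j ∷ (minor j · (δ ∘ punchIn j)))
        ≈⟨ *-congˡ (form-≈-det (·-form (∷-form form (δ j)) (δ ∘ punchIn j)) (minor j)) ⟩
      M zero j * (det (minor j) * F (δ j ∷ (δ · (δ ∘ punchIn j))))
        ≈⟨ *-congˡ (*-congˡ (cong (∷-form form (δ j)) (δ· (δ ∘ punchIn j)))) ⟩
      M zero j * (det (minor j) * F (δ j ∷ (δ ∘ punchIn j)))
        ≈⟨ *-congˡ (*-congˡ (row-to-front form j δ)) ⟩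
      M zero j * (det (minor j) * (s ^ toℕ j * F δ))
        ≈⟨ solve 4 (λ m d t f → m :* (d :* (t :* f)) := t :* (m :* d) :* f) refl _ _ _ _ ⟩
      s ^ toℕ j * (M zero j * det (minor j)) * F δ ∎

  -- As a function of `M` the left side is a form, and its value at the identity is `det B`.
  det-· : ∀ {n} (M B : Matrix n) → det (M · B) ≈ det M * det B
  det-· M B = trans (form-≈-det (·-form det-form B) M) (*-congˡ (det-cong (δ· B)))

  -- Cofactor expansions with a single surviving term.

  -- The first cofactor has coefficient zero; every other minor keeps the zero column and vanishes
  -- by induction.
  det-zero-column : ∀ {n} {M : Matrix (suc n)} → (∀ p → M p zero ≈ 0#) → det M ≈ 0#
  det-zero-column {n} {M} eq = sum≈0 {f = λ j → s ^ toℕ j * (M zero j * det λ p → M (suc p) ∘ punchIn j)} (term {M = M} eq)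
    where
    term : ∀ {n} {M : Matrix (suc n)} → (∀ p → M p zero ≈ 0#) →
           ∀ j → s ^ toℕ j * (M zero j * det λ p → M (suc p) ∘ punchIn j) ≈ 0#
    term eq zero = trans (*-congˡ (trans (*-congʳ (eq zero)) (zeroˡ _))) (zeroʳ _)
    term {suc n} {M} eq (suc j) = trans (*-congˡ (trans
      (*-congˡ (det-zero-column {M = λ p → M (suc p) ∘ punchIn (suc j)} (eq ∘ suc))) (zeroʳ _))) (zeroʳ _)

  det-first-column : ∀ {n} {M : Matrix (suc n)} → M zero zero ≈ 1# → (∀ p → M (suc p) zero ≈ 0#) →
                     det M ≈ det (λ p q → M (suc p) (suc q))
  det-first-column {n} {M} eq eq0 = begin
    1# * (M zero zero * det minor) + sum (λ j → s ^ toℕ (suc j) * (M zero (suc j) * det λ p → M (suc p) ∘ punchIn (suc j)))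
      ≈⟨ +-cong (trans (*-identityˡ _) (trans (*-congʳ eq) (*-identityˡ _)))
                (sum≈0 {f = λ j → s ^ toℕ (suc j) * (M zero (suc j) * det λ p → M (suc p) ∘ punchIn (suc j))} (term {M = M} eq0)) ⟩
    det minor + 0#  ≈⟨ +-identityʳ _ ⟩
    det minor ∎
    where
    minor : Matrix n
    minor p q = M (suc p) (suc q)
    term : ∀ {n} {M : Matrix (suc n)} → (∀ p → M (suc p) zero ≈ 0#) →
           ∀ j → s ^ toℕ (suc j) * (M zero (suc j) * det λ p → M (suc p) ∘ punchIn (suc j)) ≈ 0#
    term {suc n} {M} eq0 j = trans (*-congˡ (trans
      (*-congˡ (det-zero-column {M = λ p → M (suc p) ∘ punchIn (suc j)} eq0)) (zeroʳ _))) (zeroʳ _)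

  punchIn-fromℕ : ∀ {n} (q : Fin n) → punchIn (fromℕ n) q ≡ inject₁ q
  punchIn-fromℕ zero    = ≡.refl
  punchIn-fromℕ (suc q) = ≡.cong suc (punchIn-fromℕ q)

  det-last-of-first-row : ∀ {n} {M : Matrix (suc n)} →
                          M zero (fromℕ n) ≈ 1# → (∀ q → M zero (inject₁ q) ≈ 0#) →
                          det M ≈ s ^ n * det (λ p q → M (suc p) (inject₁ q))
  det-last-of-first-row {n} {M} eq eq0 = begin
    det M
      ≈⟨ sum-init-last t ⟩
    sum (λ q → t (inject₁ q)) + t (fromℕ n)
      ≈⟨ +-congʳ (sum≈0 (λ q → trans (*-congˡ (trans (*-congʳ (eq0 q)) (zeroˡ _))) (zeroʳ _))) ⟩
    0# + t (fromℕ n)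
      ≈⟨ +-identityˡ _ ⟩
    s ^ toℕ (fromℕ n) * (M zero (fromℕ n) * det λ p → M (suc p) ∘ punchIn (fromℕ n))
      ≈⟨ *-cong (reflexive (≡.cong (s ^_) (Fin.toℕ-fromℕ n)))
           (trans (*-congʳ eq) (trans (*-identityˡ _)
             (det-cong λ p q → reflexive (≡.cong (M (suc p)) (punchIn-fromℕ q))))) ⟩
    s ^ n * det (λ p q → M (suc p) (inject₁ q)) ∎
    where
    t : Vector Carrier (suc n)
    t j = s ^ toℕ j * (M zero j * det λ p → M (suc p) ∘ punchIn j)

  det-δ : ∀ n → det (δ {n}) ≈ 1#
  det-δ zero    = refl
  det-δ (suc n) = trans (det-first-column {M = δ {suc n}} refl (λ p → refl)) (det-δ n)

  -- Block diagonal determinants.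

  BlockForm : ∀ {a b} → ((Fin a × Fin b → Vector Carrier b) → Carrier) → Set (c ⊔ ℓ)
  BlockForm = IsAlternating (λ i k → proj₁ i ≡ proj₁ k)

  infixr 5 _∷ᵇ_
  _∷ᵇ_ : ∀ {a b} → Matrix b → (Fin a × Fin b → Vector Carrier b) → Fin (suc a) × Fin b → Vector Carrier b
  (Y ∷ᵇ K) (zero  , β) = Y β
  (Y ∷ᵇ K) (suc α , β) = K (α , β)

  -- With the other matrices fixed, `F` is a form in the first one, so `form-≈-det` replaces that
  -- matrix by the identity at the cost of its determinant. What remains is a block form in one
  -- matrix fewer.
  block-form-≈-product : ∀ {a b} {F : (Fin a × Fin b → Vector Carrier b) → Carrier} → BlockForm F →
                         ∀ K → F K ≈ product (λ α → det (λ β → K (α , β))) * F (δ ∘ proj₂)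
  block-form-≈-product {zero}  {F = F} form K = trans (cong form λ ()) (sym (*-identityˡ _))
  block-form-≈-product {suc a} {b} {F} form K = begin
    F K
      ≈⟨ cong form (λ { (zero , β) q → refl ; (suc α , β) q → refl }) ⟩
    F (K₀ ∷ᵇ K₁)
      ≈⟨ form-≈-det head-form K₀ ⟩
    det K₀ * F (δ ∷ᵇ K₁)
      ≈⟨ *-congˡ (block-form-≈-product tail-form K₁) ⟩
    det K₀ * (product (λ α → det (λ β → K₁ (α , β))) * F (δ ∷ᵇ δ ∘ proj₂))
      ≈⟨ *-assoc _ _ _ ⟨
    det K₀ * product (λ α → det (λ β → K₁ (α , β))) * F (δ ∷ᵇ δ ∘ proj₂)
      ≈⟨ *-congˡ (cong form λ { (zero , β) q → refl ; (suc α , β) q → refl }) ⟩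
    det K₀ * product (λ α → det (λ β → K₁ (α , β))) * F (δ ∘ proj₂) ∎
    where
    K₀ : Matrix b
    K₀ β = K (zero , β)
    K₁ : Fin a × Fin b → Vector Carrier b
    K₁ (α , β) = K (suc α , β)
    head-form : Form (λ Y → F (Y ∷ᵇ K₁))
    head-form = record
      { cong = λ eq → cong form λ { (zero , β) → eq β ; (suc α , β) q → refl }
      ; linear = λ i x eq eqU eqV → linear form (zero , i) x eq
          (λ { (zero , β) β≢i → eqU β (β≢i ∘ ≡.cong (zero ,_)) ; (suc α , β) _ q → refl })
          (λ { (zero , β) β≢i → eqV β (β≢i ∘ ≡.cong (zero ,_)) ; (suc α , β) _ q → refl })
      ; alternate = λ i≢k _ eq → alternate form {zero , _} {zero , _} (i≢k ∘ ≡.cong proj₂) ≡.refl eq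
      }
    shift : ∀ {i k : Fin a × Fin b} → (suc (proj₁ i) , proj₂ i) ≡ (suc (proj₁ k) , proj₂ k) → i ≡ k
    shift ≡.refl = ≡.refl
    tail-form : BlockForm (λ L → F (δ ∷ᵇ L))
    tail-form = record
      { cong = λ eq → cong form λ { (zero , β) q → refl ; (suc α , β) → eq (α , β) }
      ; linear = λ i x eq eqU eqV → linear form (suc (proj₁ i) , proj₂ i) x eq
          (λ { (zero , β) _ q → refl ; (suc α , β) k≢i → eqU (α , β) (k≢i ∘ ≡.cong λ (α , β) → suc α , β) })
          (λ { (zero , β) _ q → refl ; (suc α , β) k≢i → eqV (α , β) (k≢i ∘ ≡.cong λ (α , β) → suc α , β) })
      ; alternate = λ {i} {k} i≢k i~k eq →
          alternate form {suc (proj₁ i) , proj₂ i} {suc (proj₁ k) , proj₂ k} (i≢k ∘ shift) (≡.cong suc i~k) eq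
      }

  -- The index bijection is a parameter because two groupings of the same indices are needed: by
  -- block row, and by position inside a block.
  module BlockDiagonal {n a b} (e : Fin n ↔ (Fin a × Fin b)) where

    open Inverse e using (to; from; strictlyInverseˡ; strictlyInverseʳ)

    blockDiagonal : (Fin a × Fin b → Vector Carrier b) → Matrix n
    blockDiagonal K i j = δ (proj₁ (to i)) (proj₁ (to j)) * K (to i) (proj₂ (to j))

    from-injective : ∀ {x y} → from x ≡ from y → x ≡ y
    from-injective eq = ≡.trans (≡.sym (strictlyInverseˡ _)) (≡.trans (≡.cong to eq) (strictlyInverseˡ _))

    to-≢ : ∀ {k x} → k ≢ from x → to k ≢ x
    to-≢ k≢ eq = k≢ (≡.trans (≡.sym (strictlyInverseʳ _)) (≡.cong from eq))

    -- Rows of different blocks have disjoint supports, so equal rows of `K` yield equal rows of the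
    -- matrix only within one block. This is why alternation is asked for just there.
    blockDiagonal-form : BlockForm (λ K → det (blockDiagonal K))
    blockDiagonal-form = record
      { cong = λ eq → det-cong λ i j → *-congˡ (eq (to i) _)
      ; linear = λ i x {M} {U} {V} eq eqU eqV → linear det-form (from i) x
          {blockDiagonal M} {blockDiagonal U} {blockDiagonal V}
          (λ j → begin
            δ (proj₁ (to (from i))) (proj₁ (to j)) * M (to (from i)) (proj₂ (to j))
              ≈⟨ *-congˡ (≡.subst (λ r → M r (proj₂ (to j)) ≈ x * U r _ + V r _) (≡.sym (strictlyInverseˡ i)) (eq (proj₂ (to j)))) ⟩
            δ (proj₁ (to (from i))) (proj₁ (to j)) * (x * U (to (from i)) (proj₂ (to j)) + V (to (from i)) (proj₂ (to j)))
              ≈⟨ solve 4 (λ d x u v → d :* (x :* u :+ v) := x :* (d :* u) :+ d :* v) refl _ x _ _ ⟩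
            x * blockDiagonal U (from i) j + blockDiagonal V (from i) j ∎)
          (λ k k≢i j → *-congˡ (eqU (to k) (to-≢ k≢i) _))
          (λ k k≢i j → *-congˡ (eqV (to k) (to-≢ k≢i) _))
      ; alternate = λ {i} {k} {M} i≢k i~k eq →
          alternate det-form {from i} {from k} {blockDiagonal M} (i≢k ∘ from-injective) tt
          (λ j → ≡.subst₂
            (λ r t → δ (proj₁ r) (proj₁ (to j)) * M r (proj₂ (to j)) ≈
                     δ (proj₁ t) (proj₁ (to j)) * M t (proj₂ (to j)))
            (≡.sym (strictlyInverseˡ i)) (≡.sym (strictlyInverseˡ k))
            (*-cong (reflexive (≡.cong (λ α → δ α _) i~k)) (eq _)))
      }

    blockDiagonal-δ : ∀ i j → blockDiagonal (δ ∘ proj₂) i j ≈ δ i j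
    blockDiagonal-δ i j with i Fin.≟ j | proj₁ (to i) Fin.≟ proj₁ (to j) | proj₂ (to i) Fin.≟ proj₂ (to j)
    ... | yes ≡.refl | _ | _ = begin
      δ (proj₁ (to i)) (proj₁ (to i)) * δ (proj₂ (to i)) (proj₂ (to i))  ≈⟨ *-cong (δ-refl (proj₁ (to i))) (δ-refl (proj₂ (to i))) ⟩
      1# * 1#                                                            ≈⟨ *-identityˡ 1# ⟩
      1#                                                                 ≈⟨ δ-refl i ⟨
      δ i i                                                              ∎
    ... | no i≢j | yes p | yes q = contradiction
      (≡.trans (≡.sym (strictlyInverseʳ i)) (≡.trans (≡.cong from (≡.cong₂ _,_ p q)) (strictlyInverseʳ j))) i≢j
    ... | no i≢j | no p | _ = trans (*-congʳ (δ-≢ p)) (trans (zeroˡ _) (sym (δ-≢ i≢j)))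
    ... | no i≢j | yes _ | no q = trans (*-congˡ (δ-≢ q)) (trans (zeroʳ _) (sym (δ-≢ i≢j)))

    -- The constant left by uniqueness is the value at identity blocks, which form the identity
    -- matrix.
    det-blockDiagonal : ∀ K → det (blockDiagonal K) ≈ product (λ α → det (λ β → K (α , β)))
    det-blockDiagonal K = begin
      det (blockDiagonal K)
        ≈⟨ block-form-≈-product blockDiagonal-form K ⟩
      product (λ α → det (λ β → K (α , β))) * det (blockDiagonal (δ ∘ proj₂))
        ≈⟨ *-congˡ (trans (det-cong blockDiagonal-δ) (det-δ n)) ⟩
      product (λ α → det (λ β → K (α , β))) * 1#
        ≈⟨ *-identityʳ _ ⟩
      product (λ α → det (λ β → K (α , β))) ∎

  -- Sums over pairs of indices.

  sum-++ : ∀ m {n} (f : Vector Carrier (m ℕ.+ n)) → sum f ≈ sum (λ i → f (i ↑ˡ n)) + sum (λ j → f (m ↑ʳ j))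
  sum-++ zero    f = sym (+-identityˡ _)
  sum-++ (suc m) f = trans (+-congˡ (sum-++ m (tail f))) (sym (+-assoc _ _ _))

  sum-combine : ∀ n {m} (f : Vector Carrier (n ℕ.* m)) → sum f ≈ sum (λ (i : Fin n) → sum (λ (j : Fin m) → f (combine i j)))
  sum-combine zero        f = refl
  sum-combine (suc n) {m} f = trans (sum-++ m f) (+-congˡ (sum-combine n (λ i → f (m ↑ʳ i))))

  sum-remQuot : ∀ n {m} (f : Fin n × Fin m → Carrier) →
                sum (λ i → f (remQuot {n} m i)) ≈ sum (λ (i : Fin n) → sum (λ (j : Fin m) → f (i , j)))
  sum-remQuot n {m} f = trans (sum-combine n (λ i → f (remQuot {n} m i)))
    (sum-cong-≋ λ i → sum-cong-≋ λ j → reflexive (≡.cong f (Fin.remQuot-combine i j)))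

  -- The triangular matrix of ones and its reversals.

  -- The indicator of `t ≤ i`.
  upper : ∀ {m} → Matrix m
  upper zero    _       = 1#
  upper (suc t) zero    = 0#
  upper (suc t) (suc i) = upper t i

  upper-absorb : ∀ {m} {t u : Fin m} i → t Fin.≤ u → upper t i * upper u i ≈ upper u i
  upper-absorb {t = zero}                i       _          = *-identityˡ _
  upper-absorb {t = suc t} {u = suc u} zero    _          = zeroˡ _
  upper-absorb {t = suc t} {u = suc u} (suc i) (ℕ.s≤s t≤u) = upper-absorb i t≤u

  upper-fromℕ : ∀ n → upper (fromℕ n) (fromℕ n) ≈ 1#
  upper-fromℕ zero    = refl
  upper-fromℕ (suc n) = upper-fromℕ n

  upper-fromℕ-inject₁ : ∀ {n} (q : Fin n) → upper (fromℕ n) (inject₁ q) ≈ 0#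
  upper-fromℕ-inject₁ zero    = refl
  upper-fromℕ-inject₁ (suc q) = upper-fromℕ-inject₁ q

  upper-inject₁ : ∀ {n} (p q : Fin n) → upper (inject₁ p) (inject₁ q) ≈ upper p q
  upper-inject₁ zero    q       = refl
  upper-inject₁ (suc p) zero    = refl
  upper-inject₁ (suc p) (suc q) = upper-inject₁ p q

  opposite-inject₁ : ∀ {n} (q : Fin n) → opposite (inject₁ q) ≡ suc (opposite q)
  opposite-inject₁ zero    = ≡.refl
  opposite-inject₁ (suc q) = ≡.cong inject₁ (opposite-inject₁ q)

  opposite-fromℕ : ∀ n → opposite (fromℕ n) ≡ zero
  opposite-fromℕ zero    = ≡.refl
  opposite-fromℕ (suc n) = ≡.cong inject₁ (opposite-fromℕ n)

  det-upper : ∀ m → det (upper {m}) ≈ 1#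
  det-upper zero    = refl
  det-upper (suc m) = trans (det-first-column {M = upper {suc m}} refl (λ p → refl)) (det-upper m)

  -- The sign of the permutation that reverses `m` items, in the recursive form in which the
  -- cofactor expansion produces it.
  reversal-sign : ℕ → Carrier
  reversal-sign zero    = 1#
  reversal-sign (suc m) = s ^ m * reversal-sign m

  -- Two consecutive factors `s ^ (m + 1)` and `s ^ m` multiply to `s`, so each increase of the size
  -- by two contributes one `s`.
  reversal-sign-≈ : ∀ m → reversal-sign m ≈ s ^ ℕ.⌊ m /2⌋
  reversal-sign-≈ zero          = refl
  reversal-sign-≈ (suc zero)    = *-identityˡ 1#
  reversal-sign-≈ (suc (suc m)) = begin
    s * s ^ m * (s ^ m * reversal-sign m)    ≈⟨ solve 3 (λ s t r → s :* t :* (t :* r) := (t :* t) :* (s :* r)) refl s (s ^ m) _ ⟩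
    (s ^ m * s ^ m) * (s * reversal-sign m)  ≈⟨ *-cong (sⁿ*sⁿ≈1 m) (*-congˡ (reversal-sign-≈ m)) ⟩
    1# * (s * s ^ ℕ.⌊ m /2⌋)                 ≈⟨ *-identityˡ _ ⟩
    s * s ^ ℕ.⌊ m /2⌋                        ∎

  -- The first row has its only 1 in the last column; deleting both leaves the same matrix one size
  -- smaller.
  det-reversed-rows : ∀ m → det (upper {m} ∘ opposite) ≈ reversal-sign m
  det-reversed-rows zero    = refl
  det-reversed-rows (suc m) = begin
    det (upper {suc m} ∘ opposite)
      ≈⟨ det-last-of-first-row {M = upper {suc m} ∘ opposite} (upper-fromℕ m) upper-fromℕ-inject₁ ⟩
    s ^ m * det {m} (λ p q → upper (inject₁ (opposite p)) (inject₁ q))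
      ≈⟨ *-congˡ (trans (det-cong {m} λ p q → upper-inject₁ (opposite p) q) (det-reversed-rows m)) ⟩
    s ^ m * reversal-sign m ∎

  det-reversed-columns : ∀ m → det (λ a q → upper {m} (opposite q) a) ≈ reversal-sign m
  det-reversed-columns zero    = refl
  det-reversed-columns (suc m) = begin
    det (λ a q → upper {suc m} (opposite q) a)
      ≈⟨ det-last-of-first-row {M = λ a q → upper {suc m} (opposite q) a}
           (reflexive (≡.cong (λ t → upper t zero) (opposite-fromℕ m)))
           (λ q → reflexive (≡.cong (λ t → upper t zero) (opposite-inject₁ q))) ⟩
    s ^ m * det {m} (λ a q → upper (opposite (inject₁ q)) (suc a))
      ≈⟨ *-congˡ (trans
           (det-cong {m} λ a q →
             reflexive (≡.cong (λ t → upper t (suc a)) (opposite-inject₁ q)))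
           (det-reversed-columns m)) ⟩
    s ^ m * reversal-sign m ∎

  -- Factorization of a single block.

  telescope : ∀ {m} (x : Vector Carrier m) → let y = insertAt x (fromℕ m) 0# in
              sum (λ i → y (inject₁ i) - y (suc i)) ≈ y zero
  telescope {zero}  x = refl
  telescope {suc m} x = begin
    (x zero - y) + sum (λ i → insertAt (tail x) (fromℕ m) 0# (inject₁ i) - insertAt (tail x) (fromℕ m) 0# (suc i))
      ≈⟨ +-congˡ (telescope (tail x)) ⟩
    (x zero - y) + y    ≈⟨ +-assoc _ _ _ ⟩
    x zero + (- y + y)  ≈⟨ +-congˡ (-‿inverseˡ y) ⟩
    x zero + 0#         ≈⟨ +-identityʳ _ ⟩
    x zero              ∎
    where y = insertAt (tail x) (fromℕ m) 0# zero

  -- The indicator discards the differences before position `t`; the others telescope from `x t`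
  -- down to the appended `0#`.
  telescope-from : ∀ {m} (x : Vector Carrier m) t → let y = insertAt x (fromℕ m) 0# in
                   sum (λ i → upper t i * (y (inject₁ i) - y (suc i))) ≈ x t
  telescope-from {suc m} x zero    = trans (sum-cong-≋ λ i → *-identityˡ (y (inject₁ i) - y (suc i))) (telescope x)
    where y = insertAt x (suc (fromℕ m)) 0#
  telescope-from {suc m} x (suc t) =
    trans (+-cong (zeroˡ _) (telescope-from (tail x) t)) (+-identityˡ _)

  -- `C` takes the maximum of `p` and `opposite q`. In `A`, `opposite` turns the minimum into the
  -- maximum of `opposite p` and `opposite q`. So both kinds share the right factor, and only the
  -- left one depends on parity.
  left : Bool → ∀ {m} → Matrix m
  left isC p = if isC then upper p else upper (opposite p)

  opposite-anti-≤ : ∀ {m} {p q : Fin m} → p Fin.≤ q → opposite q Fin.≤ opposite p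
  opposite-anti-≤ {m} {p} {q} p≤q = ≡.subst₂ ℕ._≤_ (≡.sym (Fin.opposite-prop q)) (≡.sym (Fin.opposite-prop p))
    (ℕ.∸-monoʳ-≤ m (ℕ.s≤s p≤q))

  -- Here `v` plays the maximum of `t` and `u`: the product of the two indicators is the indicator
  -- of the larger threshold.
  upper-upper-sum : ∀ {m} (x : Vector Carrier m) t u → let y = insertAt x (fromℕ m) 0# in
                    ∀ {v} → (∀ i → upper t i * upper u i ≈ upper v i) →
                    x v ≈ sum (λ i → upper t i * ((y (inject₁ i) - y (suc i)) * upper u i))
  upper-upper-sum {m} x t u {v} eq = sym (trans
    (sum-cong-≋ λ i → trans
      (solve 3 (λ a b d → a :* (d :* b) := (a :* b) :* d) refl (upper t i) (upper u i) (d i))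
      (*-congʳ (eq i)))
    (telescope-from x v))
    where
    d : Vector Carrier m
    d i = insertAt x (fromℕ m) 0# (inject₁ i) - insertAt x (fromℕ m) 0# (suc i)

  block-entry : ∀ isC {m} (x : Vector Carrier m) p q → let y = insertAt x (fromℕ m) 0# in
                (if isC then C x else A x) p q ≈
                sum (λ i → left isC p i * ((y (inject₁ i) - y (suc i)) * upper (opposite q) i))
  -- The arguments stand in the order in which `_⊔_` itself compares them, so the `with` also
  -- evaluates `p ⊔ opposite q`.
  block-entry true x p q with Fin.≤-total (opposite q) p
  ... | inj₁ q′≤p = upper-upper-sum x p (opposite q) λ i → trans (*-comm _ _) (upper-absorb i q′≤p)
  ... | inj₂ p≤q′ = upper-upper-sum x p (opposite q) λ i → upper-absorb i p≤q′
  block-entry false x p q with Fin.≤-total p q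
  ... | inj₁ p≤q = upper-upper-sum x (opposite p) (opposite q) λ i →
                     trans (*-comm _ _) (upper-absorb i (opposite-anti-≤ {p = p} {q} p≤q))
  ... | inj₂ q≤p = upper-upper-sum x (opposite p) (opposite q) λ i →
                     upper-absorb i (opposite-anti-≤ {p = q} {p} q≤p)

  -- Signs collected over the block rows.

  does-2∣-+2 : ∀ n → does (2 ∣? suc (suc n)) ≡ does (2 ∣? n)
  does-2∣-+2 n =
    does-⇔ (mk⇔ (λ d → ∣m+n∣m⇒∣n d ∣-refl) (∣m∣n⇒∣m+n ∣-refl)) (2 ∣? suc (suc n)) (2 ∣? n)

  -- Taken two at a time, the block rows are one odd and one even, and only the even one contributes
  -- `y`.
  product-even : ∀ N y → product (λ (r : Fin N) → if does (2 ∣? suc (toℕ r)) then y else 1#) ≈ y ^ ℕ.⌊ N /2⌋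
  product-even zero          y = refl
  product-even (suc zero)    y = *-identityˡ 1#
  product-even (suc (suc N)) y = begin
    1# * (y * product (λ (r : Fin N) → if does (2 ∣? suc (suc (suc (toℕ r)))) then y else 1#))
      ≈⟨ *-identityˡ _ ⟩
    y * product (λ (r : Fin N) → if does (2 ∣? suc (suc (suc (toℕ r)))) then y else 1#)
      ≈⟨ *-congˡ (product-cong-≋ {N} λ r → reflexive (≡.cong (λ b → if b then y else 1#) (does-2∣-+2 (suc (toℕ r))))) ⟩
    y * product (λ (r : Fin N) → if does (2 ∣? suc (toℕ r)) then y else 1#)
      ≈⟨ *-congˡ (product-even N y) ⟩
    y * y ^ ℕ.⌊ N /2⌋ ∎

  -- The factor `reversal-sign m` is what one block of `U` contributes. In an odd block row it meets
  -- a second reversal of the same sign and cancels; in an even one it stays.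
  det-left : ∀ isC m → det (left isC {m}) * reversal-sign m ≈ (if isC then s ^ ℕ.⌊ m /2⌋ else 1#)
  det-left true  m = trans (*-cong (det-upper m) (reversal-sign-≈ m)) (*-identityˡ _)
  det-left false m = trans
    (*-cong (trans (det-reversed-rows m) (reversal-sign-≈ m)) (reversal-sign-≈ m)) (sⁿ*sⁿ≈1 ℕ.⌊ m /2⌋)

  -- Factorization of `E` and its determinant.

  module _ {N m : ℕ} (x : Fin N → Fin N → Vector Carrier m) where

    open BlockDiagonal (Fin.*↔× {N} {m}) using () renaming (blockDiagonal to outer; det-blockDiagonal to det-outer)
    open BlockDiagonal (×-comm (Fin N) (Fin m) ↔-∘ Fin.*↔× {N} {m}) using () renaming (blockDiagonal to inner; det-blockDiagonal to det-inner)

    isC : Fin N → Bool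
    isC r = does (2 ∣? suc (toℕ r))

    -- `W` and `U` act inside each block row, whereas `D` mixes block rows at a fixed inner position
    -- `a`. Hence `D` is block diagonal only in the regrouped indexing `inner`.
    W D U : Matrix (N ℕ.* m)
    W = outer λ (r , p) → left (isC r) p
    D = inner λ (a , r) → X x a r
    U = outer λ (_ , a) q → upper (opposite q) a

    D·U : ∀ i j → let r , a = remQuot {N} m i ; t , q = remQuot {N} m j in
          (D · U) i j ≈ X x a r t * upper (opposite q) a
    D·U i j = begin
      (D · U) i j
        ≈⟨ sum-remQuot N (λ (t′ , b) → (δ a b * X x a r t′) * (δ t′ t * upper (opposite q) b)) ⟩
      sum (λ t′ → sum (λ b → (δ a b * X x a r t′) * (δ t′ t * upper (opposite q) b)))
        -- `D` preserves the inner position, which fixes `b = a`; `U` preserves the block, which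
        -- then fixes `t′ = t`.
        ≈⟨ sum-cong-≋ (λ t′ → trans
             (sum-cong-≋ λ b → solve 4 (λ d y e u → (d :* y) :* (e :* u) := d :* (y :* u :* e)) refl
               (δ a b) (X x a r t′) (δ t′ t) (upper (opposite q) b))
             (sum-δˡ a (λ b → X x a r t′ * upper (opposite q) b * δ t′ t))) ⟩
      sum (λ t′ → X x a r t′ * upper (opposite q) a * δ t′ t)
        ≈⟨ sum-δʳ t (λ t′ → X x a r t′ * upper (opposite q) a) ⟩
      X x a r t * upper (opposite q) a ∎
      where
      r = proj₁ (remQuot {N} m i)
      a = proj₂ (remQuot {N} m i)
      t = proj₁ (remQuot {N} m j)
      q = proj₂ (remQuot {N} m j)

    E-factors : ∀ i j → E x i j ≈ (W · (D · U)) i j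
    E-factors i j = sym (begin
      (W · (D · U)) i j
        ≈⟨ sum-cong-≋ (λ k → *-congˡ {W i k} (D·U k j)) ⟩
      sum (λ k → W i k * (X x (proj₂ (remQuot {N} m k)) (proj₁ (remQuot {N} m k)) t * upper (opposite q) (proj₂ (remQuot {N} m k))))
        ≈⟨ sum-remQuot N (λ (r′ , a) → (δ r r′ * left (isC r) p a) * (X x a r′ t * upper (opposite q) a)) ⟩
      sum (λ r′ → sum (λ a → (δ r r′ * left (isC r) p a) * (X x a r′ t * upper (opposite q) a)))
        ≈⟨ sum-cong-≋ (λ r′ → trans (sum-cong-≋ λ a → *-assoc (δ r r′) (left (isC r) p a) _)
             (sym (*-distribˡ-sum (δ r r′) (λ a → left (isC r) p a * (X x a r′ t * upper (opposite q) a))))) ⟩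
      sum (λ r′ → δ r r′ * sum (λ a → left (isC r) p a * (X x a r′ t * upper (opposite q) a)))
        -- Only block row `r` survives, and the remaining sum is the formula of `block-entry`.
        ≈⟨ sum-δˡ r (λ r′ → sum (λ a → left (isC r) p a * (X x a r′ t * upper (opposite q) a))) ⟩
      sum (λ a → left (isC r) p a * (X x a r t * upper (opposite q) a))
        ≈⟨ block-entry (isC r) (x r t) p q ⟨
      E x i j ∎)
      where
      r = proj₁ (remQuot {N} m i)
      p = proj₂ (remQuot {N} m i)
      t = proj₁ (remQuot {N} m j)
      q = proj₂ (remQuot {N} m j)

    det-E : det (E x) ≈ s ^ (ℕ.⌊ m /2⌋ ℕ.* ℕ.⌊ N /2⌋) * product (λ i → det (X x i))
    det-E = begin
      det (E x)
        ≈⟨ det-cong E-factors ⟩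
      det (W · (D · U))
        ≈⟨ trans (det-· W (D · U)) (*-congˡ (det-· D U)) ⟩
      det W * (det D * det U)
        -- Regrouping moves rows and columns of `D` alike, so it contributes no sign.
        ≈⟨ *-cong (det-outer _) (*-cong (det-inner _)
             (trans (det-outer _) (product-cong-≋ {N} λ _ → det-reversed-columns m))) ⟩
      product (λ r → det (left (isC r) {m})) * (∏X * product {N} (λ _ → reversal-sign m))
        -- The signs from `U` are brought next to `W`, to be paired block row by block row.
        ≈⟨ solve 3 (λ a b c → a :* (b :* c) := (a :* c) :* b) refl _ _ _ ⟩
      product (λ r → det (left (isC r) {m})) * product {N} (λ _ → reversal-sign m) * ∏X
        ≈⟨ *-congʳ (∏-distrib-* (λ r → det (left (isC r) {m})) (λ _ → reversal-sign m)) ⟨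
      product (λ r → det (left (isC r) {m}) * reversal-sign m) * ∏X
        ≈⟨ *-congʳ (product-cong-≋ λ r → det-left (isC r) m) ⟩
      product (λ r → if isC r then s ^ ℕ.⌊ m /2⌋ else 1#) * ∏X
        ≈⟨ *-congʳ (trans (product-even N _) (^-assocʳ s ℕ.⌊ m /2⌋ ℕ.⌊ N /2⌋)) ⟩
      s ^ (ℕ.⌊ m /2⌋ ℕ.* ℕ.⌊ N /2⌋) * ∏X ∎
      where ∏X = product (λ i → det (X x i))

-- Exponents in the four parity cases.

halves : ∀ n → n ≡ ℕ.⌊ n /2⌋ ℕ.* 2 ⊎ n ≡ suc (ℕ.⌊ n /2⌋ ℕ.* 2)
halves zero          = inj₁ ≡.refl
halves (suc zero)    = inj₂ ≡.refl
halves (suc (suc n)) = Sum.map (≡.cong (2 ℕ.+_)) (≡.cong (2 ℕ.+_)) (halves n)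

half-even : ∀ {n} → 2 ∣ n → n ≡ ℕ.⌊ n /2⌋ ℕ.* 2
half-even {n} 2∣n with halves n
... | inj₁ eq = eq
... | inj₂ eq = contradiction
  (∣1⇒≡1 (∣m+n∣m⇒∣n (≡.subst (2 ∣_) (≡.trans eq (ℕ.+-comm 1 _)) 2∣n) (divides ℕ.⌊ n /2⌋ ≡.refl)))
  λ ()

half-odd : ∀ {n} → 2 ∤ n → n ∸ 1 ≡ ℕ.⌊ n /2⌋ ℕ.* 2
half-odd {n} 2∤n with halves n
... | inj₁ eq = contradiction (divides ℕ.⌊ n /2⌋ eq) 2∤n
... | inj₂ eq = ≡.cong (_∸ 1) eq

-- Both numbers are even, so 4 divides their product and the truncating division is exact.
quarter : ∀ {n m} h k → n ≡ h ℕ.* 2 → m ≡ k ℕ.* 2 → k ℕ.* h ≡ (n ℕ.* m) / 4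
quarter h k ≡.refl ≡.refl = ≡.sym (≡.trans (≡.cong (_/ 4) (regroup h k)) (m*n/n≡m (k ℕ.* h) 4))
  where
  open ℕ-Solver.+-*-Solver
  regroup : ∀ h k → (h ℕ.* 2) ℕ.* (k ℕ.* 2) ≡ (k ℕ.* h) ℕ.* 4
  regroup = solve 2 (λ h k → (h :* con 2) :* (k :* con 2) := (k :* h) :* con 4) ≡.refl

theorem3p1 : ∀ {c ℓ} (R : CommutativeRing c ℓ) →
    let open CommutativeRing R
        open OverRing R in
    (N m : ℕ) → 2 ≤ N → 1 ≤ m →
    (x : Fin N → Fin N → Vector Carrier m) →
      (2 ∣ N → 2 ∣ m →
        det (E x) ≈ (- 1#) ^ ((N ℕ.* m) / 4) * product (λ i → det (X x i)))
    × (2 ∣ N → 2 ∤ m →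
        det (E x) ≈ (- 1#) ^ ((N ℕ.* (m ∸ 1)) / 4) * product (λ i → det (X x i)))
    × (2 ∤ N → 2 ∣ m →
        det (E x) ≈ (- 1#) ^ (((N ∸ 1) ℕ.* m) / 4) * product (λ i → det (X x i)))
    × (2 ∤ N → 2 ∤ m →
        det (E x) ≈ (- 1#) ^ (((N ∸ 1) ℕ.* (m ∸ 1)) / 4) * product (λ i → det (X x i)))
theorem3p1 R N m _ _ x =
    (λ 2∣N 2∣m → exponent (half-even 2∣N) (half-even 2∣m))
  , (λ 2∣N 2∤m → exponent (half-even 2∣N) (half-odd 2∤m))
  , (λ 2∤N 2∣m → exponent (half-odd 2∤N) (half-even 2∣m))
  , (λ 2∤N 2∤m → exponent (half-odd 2∤N) (half-odd 2∤m))
  where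
  open CommutativeRing R
  open OverRing R
  -- `n` and `k` are `N` and `m` rounded down to even numbers. Their halves are the same floors in
  -- all four cases, so `det-E` serves each of them.
  exponent : ∀ {n k} → n ≡ ℕ.⌊ N /2⌋ ℕ.* 2 → k ≡ ℕ.⌊ m /2⌋ ℕ.* 2 →
             det (E x) ≈ (- 1#) ^ ((n ℕ.* k) / 4) * product (λ i → det (X x i))
  exponent n≡ k≡ = ≡.subst (λ e → det (E x) ≈ (- 1#) ^ e * product (λ i → det (X x i)))
    (quarter ℕ.⌊ N /2⌋ ℕ.⌊ m /2⌋ n≡ k≡) (Determinants.det-E R x)
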